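{- Let $G$ be an FTD-admissible graph of order $n$ and let $k = 1+\lfloor \log_2 (n+1) \rfloor \ge 5$. Then $\gamma^{\mathrm{FTD}}(G) = k$ if and only if $G$ can be obtained (up to isomorphism) from some graph $G^F(k) = (C \cup (V \setminus C),E)$ for which $G^F(k)[C]$ is FTD-admissible, by removing up to $2^{k-1}-k$ vertices of $V \setminus C$.
   Context: Graphs are finite, simple and undirected. For a graph $G=(V,E)$ and $v\in V$, $N(v)$ is the open neighborhood and $N[v]=N(v)\cup\{v\}$ the closed neighborhood; $G[C]$ is the subgraph induced by $C$. Open twins are distinct non-adjacent vertices $u,v$ with $N(u)=N(v)$; closed twins are distinct adjacent vertices $u,v$ with $N[u]=N[v]$. A set $C\subseteq V$ is total-dominating if $N(v)\cap C\neq\emptyset$ for all $v\in V$, and full-separating if $N(u)\cap C\neq N(v)\cap C$ and $N[u]\cap C\neq N[v]\cap C$ for all distinct $u,v\in V$. An FTD-code is a set that is both full-separating and total-dominating. A graph is FTD-admissible if it has an FTD-code (equivalently, it has no isolated vertices, no open twins and no closed twins); $\gamma^{\mathrm{FTD}}(G)$ is the minimum cardinality of an FTD-code of $G$. For $k\ge 4$, $G^F(k)$ denotes any graph with vertex set $V$ and a subset $C\subseteq V$ such that $|C|=k$, the induced subgraph $G^F(k)[C]$ has neither open nor closed twins, and $V\setminus C$ consists of exactly one vertex $v_{C'}$ with $N(v_{C'})\cap C=C'$ for each non-empty subset $C'\subseteq C$ such that there is no vertex $u\in C$ with either $N(u)\cap C=C'$ or $N[u]\cap C=C'$; there is no condition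 on the edges inside $V\setminus C$. -}

module Defs where

open import Data.Fin using (Fin; zero; suc)
open import Data.Fin.Subset
  using (Subset; inside; outside; _∈_; _∉_; _⊆_; _∩_; _∪_; ∣_∣; ⁅_⁆; Nonempty)
open import Data.Nat using (ℕ; _≤_)
open import Data.Product using (Σ; ∃; ∃!; _×_; _,_)
open import Data.Sum using (_⊎_)
open import Data.Vec using (_∷_; tabulate)
open import Function using (_↔_; _⇔_; Inverse)
open import Level using (0ℓ)
open import Relation.Binary using (Rel; Symmetric; Decidable)
open import Relation.Binary.PropositionalEquality using (_≡_; _≢_)
open import Relation.Nullary using (¬_; does)

private
  variable
    m n : ℕ

-- Decidability of adjacency is what makes neighbourhoods available as elements
-- of 'Subset n', so that '_≡_' on them is equality of sets.
record Graph (n : ℕ) : Set₁ where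
  infix 4 _~_ _~?_
  field
    _~_    : Rel (Fin n) 0ℓ
    _~?_   : Decidable _~_
    ~-sym  : Symmetric _~_
    ~-irrefl : ∀ v → ¬ (v ~ v)

  N : Fin n → Subset n
  N v = tabulate (λ w → does (v ~? w))

  N[_] : Fin n → Subset n
  N[ v ] = N v ∪ ⁅ v ⁆

infix 4 _≅_

_≅_ : Graph n → Graph m → Set
_≅_ {n} {m} G H =
  Σ (Fin n ↔ Fin m) λ φ →
    ∀ u v → (u G.~ v) ⇔ (Inverse.to φ u H.~ Inverse.to φ v)
  where
  module G = Graph G
  module H = Graph H

-- The increasing enumeration of the elements of a subset.
enum : (C : Subset n) → Fin ∣ C ∣ → Fin n
enum (inside  ∷ C) zero    = zero
enum (inside  ∷ C) (suc i) = suc (enum C i)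
enum (outside ∷ C) i       = suc (enum C i)

infixl 8 _⟦_⟧

-- The induced subgraph on C, with vertex i standing for 'enum C i'.
_⟦_⟧ : Graph n → (C : Subset n) → Graph ∣ C ∣
G ⟦ C ⟧ = record
  { _~_      = λ i j → enum C i ~ enum C j
  ; _~?_     = λ i j → enum C i ~? enum C j
  ; ~-sym    = ~-sym
  ; ~-irrefl = λ i → ~-irrefl (enum C i)
  }
  where open Graph G

module _ (G : Graph n) where
  open Graph G

  OpenTwins : Rel (Fin n) 0ℓ
  OpenTwins u v = u ≢ v × ¬ (u ~ v) × N u ≡ N v

  ClosedTwins : Rel (Fin n) 0ℓ
  ClosedTwins u v = u ≢ v × u ~ v × N[ u ] ≡ N[ v ]

  TotalDominating : Subset n → Set
  TotalDominating C = ∀ v → Nonempty (N v ∩ C)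

  FullSeparating : Subset n → Set
  FullSeparating C =
    ∀ u v → u ≢ v → N u ∩ C ≢ N v ∩ C × N[ u ] ∩ C ≢ N[ v ] ∩ C

  FTDCode : Subset n → Set
  FTDCode C = FullSeparating C × TotalDominating C

  FTDAdmissible : Set
  FTDAdmissible = ∃ FTDCode

  -- γ^FTD(G) = k.
  FTDNumber : ℕ → Set
  FTDNumber k =
    (∃ λ C → FTDCode C × ∣ C ∣ ≡ k) × (∀ C → FTDCode C → k ≤ ∣ C ∣)

-- G, with the designated vertex subset C, is a graph G^F(k).
record IsGF (k : ℕ) (G : Graph n) (C : Subset n) : Set where
  open Graph G

  -- The index set of the vertices v_{C'} outside C.
  Index : Subset n → Set
  Index C′ =
    C′ ⊆ C × Nonempty C′ ×
    ¬ (∃ λ u → u ∈ C × (N u ∩ C ≡ C′ ⊎ N[ u ] ∩ C ≡ C′))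

  field
    k≥4            : 4 ≤ k
    size           : ∣ C ∣ ≡ k
    no-openTwins   : ∀ i j → ¬ OpenTwins (G ⟦ C ⟧) i j
    no-closedTwins : ∀ i j → ¬ ClosedTwins (G ⟦ C ⟧) i j
    outside-index  : ∀ v → v ∉ C → Index (N v ∩ C)
    index-outside  : ∀ C′ → Index C′ → ∃! _≡_ (λ v → v ∉ C × N v ∩ C ≡ C′)

{-# OPTIONS --safe #-}
-- For an FTD-code C, the traces N(v) ∩ C (v ∈ V) and N[u] ∩ C (u ∈ C) are
-- pairwise distinct non-empty subsets of C, so n + |C| + 1 ≤ 2^|C|.  This gives
-- γ^FTD(G) ≥ k, and it bounds the order of every graph having an FTD-code of
-- size k.  Hence adding to G, one at a time, vertices whose neighbourhoods are
-- subsets of C not yet occurring as traces preserves the FTD-code C and must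
-- stop, and it can only stop at a graph G^F(k).  Conversely, C is an FTD-code of
-- G^F(k), and it remains one when vertices outside C are removed.
module Submission where

open import Defs
open import Data.Bool.Properties using (_≟_)
import Data.Empty as Empty
open import Data.Fin using (Fin; zero; suc; splitAt; combine)
import Data.Fin.Properties as Fin
open import Data.Fin.Subset
  using (Subset; Side; inside; outside; _∈_; _∉_; _⊆_; _∩_; _∪_; ∁; ∣_∣; ⁅_⁆; ⊥; ⊤; Nonempty)
open import Data.Fin.Subset.Properties
open import Data.Nat using (ℕ; zero; suc; _+_; _*_; _∸_; _^_; _≤_; z≤n; s≤s; ⌊_/2⌋; ⌈_/2⌉)
import Data.Nat.Properties as ℕ
open import Data.Nat.Logarithm using (⌊log₂_⌋; ⌊log₂⌊n/2⌋⌋≡⌊log₂n⌋∸1)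
open import Data.Product using (Σ; ∃; _×_; _,_; proj₁; proj₂)
open import Data.Sum using (_⊎_; inj₁; inj₂; [_,_])
import Data.Sum as Sum
open import Data.Vec using (_∷_; []; lookup; tabulate; here; there)
open import Data.Vec.Properties
  using (lookup∘tabulate; tabulate-cong; lookup⇒[]=; []=⇒lookup; ∷-injectiveʳ; ≡-dec)
open import Function using (_⇔_; _↔_; _∘_; id; Injection; Injective; Inverse; mk⇔; mk↔ₛ′)
open import Function.Properties.Inverse using (↔-sym; ↔⇒↣)
open import Relation.Binary.PropositionalEquality hiding ([_])
open import Relation.Nullary using (¬_; Dec; yes; no; does; contradiction)
open import Relation.Nullary.Decidable
  using (does-⇔; dec-true; decidable-stable; ¬?; _×-dec_; _⊎-dec_)

private
  variable
    m n : ℕ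

-- Powers of two and logarithms

-- Halving `x` lowers its logarithm by one, and twice `⌊ x /2⌋` is at most `x`. The condition
-- `1 ≤ x` excludes the convention that the logarithm of 0 is 0.
≤⌊log₂⌋⇒2^≤ : ∀ l x → 1 ≤ x → l ≤ ⌊log₂ x ⌋ → 2 ^ l ≤ x
≤⌊log₂⌋⇒2^≤ zero    x               1≤x _  = 1≤x
≤⌊log₂⌋⇒2^≤ (suc l) (suc zero)      _   ()
≤⌊log₂⌋⇒2^≤ (suc l) x@(suc (suc _)) _   l< = begin
  2 * 2 ^ l              ≤⟨ ℕ.*-monoʳ-≤ 2 (≤⌊log₂⌋⇒2^≤ l ⌊ x /2⌋ (s≤s z≤n) l≤) ⟩
  2 * ⌊ x /2⌋            ≡⟨ cong (⌊ x /2⌋ +_) (ℕ.+-identityʳ _) ⟩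
  ⌊ x /2⌋ + ⌊ x /2⌋      ≤⟨ ℕ.+-monoʳ-≤ ⌊ x /2⌋ (ℕ.⌊n/2⌋≤⌈n/2⌉ x) ⟩
  ⌊ x /2⌋ + ⌈ x /2⌉      ≡⟨ ℕ.⌊n/2⌋+⌈n/2⌉≡n x ⟩
  x                      ∎
  where
  open ℕ.≤-Reasoning
  l≤ : l ≤ ⌊log₂ ⌊ x /2⌋ ⌋
  l≤ = subst (l ≤_) (sym (⌊log₂⌊n/2⌋⌋≡⌊log₂n⌋∸1 x)) (ℕ.∸-monoˡ-≤ 1 l<)

2^⌊log₂⌋≤ : ∀ n → 2 ^ ⌊log₂ (n + 1) ⌋ ≤ n + 1
2^⌊log₂⌋≤ n = ≤⌊log₂⌋⇒2^≤ _ (n + 1) (ℕ.m≤n+m 1 n) ℕ.≤-refl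

-- Subsets

side→Fin : Side → Fin 2
side→Fin = Inverse.from Fin.2↔Bool

↔-injective : {A B : Set} (φ : A ↔ B) → Injective _≡_ _≡_ (Inverse.to φ)
↔-injective φ = Injection.injective (↔⇒↣ φ)

-- Landing in `Fin (2 ^ n)` lets the pigeonhole principle count subsets.
encode : Subset n → Fin (2 ^ n)
encode []      = zero
encode (s ∷ S) = combine (side→Fin s) (encode S)

encode-injective : Injective _≡_ _≡_ (encode {n})
encode-injective {x = []}    {[]}    _  = refl
encode-injective {x = s ∷ S} {t ∷ T} eq
  with s≡t , S≡T ← Fin.combine-injective (side→Fin s) (encode S) (side→Fin t) (encode T) eq
  = cong₂ _∷_ (↔-injective (↔-sym Fin.2↔Bool) s≡t) (encode-injective S≡T)

∈-tabulate-does⁺ : {P : Fin n → Set} (P? : ∀ i → Dec (P i)) → ∀ {i} →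
                   P i → i ∈ tabulate (does ∘ P?)
∈-tabulate-does⁺ P? {i} p =
  lookup⇒[]= i _ (trans (lookup∘tabulate (does ∘ P?) i) (dec-true (P? i) p))

∈-tabulate-does⁻ : {P : Fin n → Set} (P? : ∀ i → Dec (P i)) → ∀ {i} →
                   i ∈ tabulate (does ∘ P?) → P i
∈-tabulate-does⁻ P? {i} i∈ with P? i | trans (sym (lookup∘tabulate (does ∘ P?) i)) ([]=⇒lookup i∈)
... | yes p | _ = p

tabulate-∈? : (S : Subset n) → tabulate (λ i → does (i ∈? S)) ≡ S
tabulate-∈? S = ⊆-antisym (∈-tabulate-does⁻ (_∈? S)) (∈-tabulate-does⁺ (_∈? S))

∈∩-resp : (S T C : Subset n) → S ∩ C ≡ T ∩ C → ∀ {x} → x ∈ C → x ∈ S → x ∈ T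
∈∩-resp S T C eq {x} x∈C x∈S =
  proj₁ (x∈p∩q⁻ T C (subst (x ∈_) eq (x∈p∩q⁺ (x∈S , x∈C))))

preimage : (Fin n → Fin m) → Subset m → Subset n
preimage f S = tabulate (lookup S ∘ f)

module _ (f : Fin n → Fin m) where

  lookup-preimage : ∀ S i → lookup (preimage f S) i ≡ lookup S (f i)
  lookup-preimage S = lookup∘tabulate (lookup S ∘ f)

  ∈-preimage⁺ : ∀ S {i} → f i ∈ S → i ∈ preimage f S
  ∈-preimage⁺ S {i} fi∈ = lookup⇒[]= i _ (trans (lookup-preimage S i) ([]=⇒lookup fi∈))

  ∈-preimage⁻ : ∀ S {i} → i ∈ preimage f S → f i ∈ S
  ∈-preimage⁻ S {i} i∈ = lookup⇒[]= (f i) S (trans (sym (lookup-preimage S i)) ([]=⇒lookup i∈))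

  preimage-∩ : ∀ S T → preimage f (S ∩ T) ≡ preimage f S ∩ preimage f T
  preimage-∩ S T = ⊆-antisym
    (λ i∈ → let fi∈S , fi∈T = x∈p∩q⁻ S T (∈-preimage⁻ (S ∩ T) i∈)
            in x∈p∩q⁺ (∈-preimage⁺ S fi∈S , ∈-preimage⁺ T fi∈T))
    (λ i∈ → let i∈S , i∈T = x∈p∩q⁻ (preimage f S) (preimage f T) i∈
            in ∈-preimage⁺ (S ∩ T) (x∈p∩q⁺ (∈-preimage⁻ S i∈S , ∈-preimage⁻ T i∈T)))

  preimage-∪ : ∀ S T → preimage f (S ∪ T) ≡ preimage f S ∪ preimage f T
  preimage-∪ S T = ⊆-antisym
    (λ i∈ → x∈p∪q⁺ (Sum.map (∈-preimage⁺ S) (∈-preimage⁺ T)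
              (x∈p∪q⁻ S T (∈-preimage⁻ (S ∪ T) i∈))))
    (λ i∈ → ∈-preimage⁺ (S ∪ T) (x∈p∪q⁺ (Sum.map (∈-preimage⁻ S) (∈-preimage⁻ T)
              (x∈p∪q⁻ (preimage f S) (preimage f T) i∈))))

  preimage-⁅⁆ : Injective _≡_ _≡_ f → ∀ i → preimage f ⁅ f i ⁆ ≡ ⁅ i ⁆
  preimage-⁅⁆ f-inj i = ⊆-antisym
    (λ j∈ → subst (_∈ ⁅ i ⁆) (sym (f-inj (x∈⁅y⁆⇒x≡y (f i) (∈-preimage⁻ ⁅ f i ⁆ j∈)))) (x∈⁅x⁆ i))
    (λ j∈ → ∈-preimage⁺ ⁅ f i ⁆
              (subst (λ j → f j ∈ ⁅ f i ⁆) (sym (x∈⁅y⁆⇒x≡y i j∈)) (x∈⁅x⁆ (f i))))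

  Covers : Subset m → Set
  Covers C = ∀ {y} → y ∈ C → ∃ λ x → f x ≡ y

  preimage-reflects-⊆ : ∀ S T → Covers S → preimage f S ⊆ preimage f T → S ⊆ T
  preimage-reflects-⊆ S T cov sub y∈ with x , refl ← cov y∈ =
    ∈-preimage⁻ T (sub (∈-preimage⁺ S y∈))

  -- A preimage forgets only the points outside the image of `f`, so it determines every set that
  -- lies in the image.
  preimage-injective : ∀ S T → Covers S → Covers T → preimage f S ≡ preimage f T → S ≡ T
  preimage-injective S T covS covT eq = ⊆-antisym
    (preimage-reflects-⊆ S T covS (⊆-reflexive eq))
    (preimage-reflects-⊆ T S covT (⊆-reflexive (sym eq)))

enum-∈ : (C : Subset n) (i : Fin ∣ C ∣) → enum C i ∈ C
enum-∈ (inside  ∷ C) zero    = here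
enum-∈ (inside  ∷ C) (suc i) = there (enum-∈ C i)
enum-∈ (outside ∷ C) i       = there (enum-∈ C i)

enum-injective : (C : Subset n) → Injective _≡_ _≡_ (enum C)
enum-injective (inside  ∷ C) {zero}  {zero}  _  = refl
enum-injective (inside  ∷ C) {suc i} {suc j} eq = cong suc (enum-injective C (Fin.suc-injective eq))
enum-injective (outside ∷ C)                 eq = enum-injective C (Fin.suc-injective eq)

enum-covers : (C : Subset n) → Covers (enum C) C
enum-covers (inside  ∷ C) here       = zero , refl
enum-covers (inside  ∷ C) (there x∈) with i , refl ← enum-covers C x∈ = suc i , refl
enum-covers (outside ∷ C) (there x∈) with i , refl ← enum-covers C x∈ = i , refl

preimage-enum : (C : Subset n) → preimage (enum C) C ≡ ⊤
preimage-enum C = ⊆-antisym (λ _ → ∈⊤) (λ {i} _ → ∈-preimage⁺ (enum C) C (enum-∈ C i))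

-- `f` carries the enumeration of the preimage injectively into that of `C`. For codes, the opposite
-- inequality will come from the lower bound on their size.
∣preimage∣≤ : (f : Fin n → Fin m) → Injective _≡_ _≡_ f → ∀ C → ∣ preimage f C ∣ ≤ ∣ C ∣
∣preimage∣≤ f f-inj C = Fin.injective⇒≤ {f = g} λ {i} {j} gi≡gj →
  enum-injective D (f-inj (trans (sym (proj₂ (index i)))
    (trans (cong (enum C) gi≡gj) (proj₂ (index j)))))
  where
  D = preimage f C
  index : (i : Fin ∣ D ∣) → ∃ λ j → enum C j ≡ f (enum D i)
  index i = enum-covers C (∈-preimage⁻ f C (enum-∈ D i))
  g : Fin ∣ D ∣ → Fin ∣ C ∣
  g = proj₁ ∘ index

∣∁∣+∣∣ : (S : Subset n) → ∣ ∁ S ∣ + ∣ S ∣ ≡ n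
∣∁∣+∣∣ S = trans (cong (_+ ∣ S ∣) (∣∁p∣≡n∸∣p∣ S)) (ℕ.m∸n+n≡m (∣p∣≤n S))

-- Traces of neighbourhoods on a code

module _ (G : Graph n) where
  open Graph G

  ∈N⁺ : ∀ {u v} → u ~ v → v ∈ N u
  ∈N⁺ {u} = ∈-tabulate-does⁺ (u ~?_)

  ∈N⁻ : ∀ {u v} → v ∈ N u → u ~ v
  ∈N⁻ {u} = ∈-tabulate-does⁻ (u ~?_)

  v∈N[v] : ∀ v → v ∈ N[ v ]
  v∈N[v] v = x∈p∪q⁺ (inj₂ (x∈⁅x⁆ v))

  -- The only point that `N[ v ]` adds to `N v` is `v`, and the intersection with `C` discards it.
  ∉⇒N[]∩≡N∩ : ∀ {v} C → v ∉ C → N[ v ] ∩ C ≡ N v ∩ C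
  ∉⇒N[]∩≡N∩ {v} C v∉C = ⊆-antisym
    (λ x∈ → let x∈N , x∈C = x∈p∩q⁻ N[ v ] C x∈
            in x∈p∩q⁺ ([ id , (λ x∈⁅v⁆ → contradiction (subst (_∈ C) (x∈⁅y⁆⇒x≡y v x∈⁅v⁆) x∈C) v∉C) ]
                        (x∈p∪q⁻ (N v) ⁅ v ⁆ x∈N) , x∈C))
    (λ x∈ → let x∈N , x∈C = x∈p∩q⁻ (N v) C x∈
            in x∈p∩q⁺ (x∈p∪q⁺ (inj₁ x∈N) , x∈C))

  module Code {C : Subset n} (code : FTDCode G C) where

    N∩-injective : ∀ {u v} → N u ∩ C ≡ N v ∩ C → u ≡ v
    N∩-injective {u} {v} eq =
      decidable-stable (u Fin.≟ v) λ u≢v → proj₁ (proj₁ code u v u≢v) eq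

    N[]∩-injective : ∀ {u v} → N[ u ] ∩ C ≡ N[ v ] ∩ C → u ≡ v
    N[]∩-injective {u} {v} eq =
      decidable-stable (u Fin.≟ v) λ u≢v → proj₂ (proj₁ code u v u≢v) eq

    -- If `u` is in `C`, equal traces put `w` into `N u`; then `u` is in `N[ w ]`, hence in `N u`,
    -- which is a loop. If `u` is outside `C`, its open trace is also its closed one, and closed
    -- separation forces `u ≡ w`, although `w` is in `C`.
    N∩≢N[]∩ : ∀ {u w} → w ∈ C → N u ∩ C ≢ N[ w ] ∩ C
    N∩≢N[]∩ {u} {w} w∈C eq with u ∈? C
    ... | yes u∈C = ~-irrefl u (∈N⁻ (∈∩-resp N[ w ] (N u) C (sym eq) u∈C
                      (x∈p∪q⁺ (inj₁ (∈N⁺ (~-sym u~w))))))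
      where u~w = ∈N⁻ (∈∩-resp N[ w ] (N u) C (sym eq) w∈C (v∈N[v] w))
    ... | no u∉C =
      contradiction (N[]∩-injective (trans (∉⇒N[]∩≡N∩ C u∉C) eq)) λ { refl → u∉C w∈C }

    private
      -- Closed traces are indexed by `C` alone, since outside `C` they coincide with the open ones.
      trace : Fin n ⊎ Fin ∣ C ∣ → Subset n
      trace (inj₁ v) = N v ∩ C
      trace (inj₂ i) = N[ enum C i ] ∩ C

      trace⊆C : ∀ t → trace t ⊆ C
      trace⊆C (inj₁ v) = p∩q⊆q (N v) C
      trace⊆C (inj₂ i) = p∩q⊆q N[ enum C i ] C

      trace-nonempty : ∀ t → trace t ≢ ⊥
      trace-nonempty (inj₁ v) eq = let x , x∈ = proj₂ code v in ∉⊥ (subst (x ∈_) eq x∈)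
      trace-nonempty (inj₂ i) eq =
        ∉⊥ (subst (enum C i ∈_) eq (x∈p∩q⁺ (v∈N[v] (enum C i) , enum-∈ C i)))

      trace-injective : ∀ s t → trace s ≡ trace t → s ≡ t
      trace-injective (inj₁ u) (inj₁ v) eq = cong inj₁ (N∩-injective eq)
      trace-injective (inj₁ u) (inj₂ j) eq = contradiction eq (N∩≢N[]∩ (enum-∈ C j))
      trace-injective (inj₂ i) (inj₁ v) eq = contradiction (sym eq) (N∩≢N[]∩ (enum-∈ C i))
      trace-injective (inj₂ i) (inj₂ j) eq = cong inj₂ (enum-injective C (N[]∩-injective eq))

      trace₀ : Fin (1 + (n + ∣ C ∣)) → Subset n
      trace₀ zero    = ⊥
      trace₀ (suc i) = trace (splitAt n i)

      trace₀⊆C : ∀ i → trace₀ i ⊆ C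
      trace₀⊆C zero    x∈ = contradiction x∈ ∉⊥
      trace₀⊆C (suc i) x∈ = trace⊆C (splitAt n i) x∈

      trace₀-injective : Injective _≡_ _≡_ trace₀
      trace₀-injective {zero}  {zero}  _  = refl
      trace₀-injective {zero}  {suc j} eq = contradiction (sym eq) (trace-nonempty (splitAt n j))
      trace₀-injective {suc i} {zero}  eq = contradiction eq (trace-nonempty (splitAt n i))
      trace₀-injective {suc i} {suc j} eq =
        cong suc (↔-injective (Fin.+↔⊎ {n}) (trace-injective _ _ eq))

    -- The leading 1 counts the empty set, which is not a trace. Pulling back along `enum C` loses
    -- nothing, because all these sets lie in `C`, and it turns them into distinct subsets of a set
    -- with `∣ C ∣` elements.
    order-bound : 1 + (n + ∣ C ∣) ≤ 2 ^ ∣ C ∣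
    order-bound = Fin.injective⇒≤ {f = encode ∘ preimage (enum C) ∘ trace₀} λ {i} {j} eq →
      trace₀-injective (preimage-injective (enum C) (trace₀ i) (trace₀ j)
        (enum-covers C ∘ trace₀⊆C i) (enum-covers C ∘ trace₀⊆C j) (encode-injective eq))

-- Embeddings of graphs

module Embedding (G : Graph n) (H : Graph m) (f : Fin n → Fin m)
  (f-injective : Injective _≡_ _≡_ f)
  (f-adjacency : ∀ u v → Graph._~_ G u v ⇔ Graph._~_ H (f u) (f v))
  where
  private
    module G = Graph G
    module H = Graph H

  preimage-N : ∀ v → preimage f (H.N (f v)) ≡ G.N v
  preimage-N v = tabulate-cong λ w → trans (lookup∘tabulate _ (f w))
    (sym (does-⇔ (f-adjacency v w) (v G.~? w) (f v H.~? f w)))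

  preimage-N[] : ∀ v → preimage f H.N[ f v ] ≡ G.N[ v ]
  preimage-N[] v = trans (preimage-∪ f (H.N (f v)) ⁅ f v ⁆)
    (cong₂ _∪_ (preimage-N v) (preimage-⁅⁆ f f-injective v))

  module _ (C : Subset m) where

    preimage-N∩ : ∀ v → preimage f (H.N (f v) ∩ C) ≡ G.N v ∩ preimage f C
    preimage-N∩ v = trans (preimage-∩ f (H.N (f v)) C) (cong (_∩ preimage f C) (preimage-N v))

    preimage-N[]∩ : ∀ v → preimage f (H.N[ f v ] ∩ C) ≡ G.N[ v ] ∩ preimage f C
    preimage-N[]∩ v = trans (preimage-∩ f H.N[ f v ] C) (cong (_∩ preimage f C) (preimage-N[] v))

    -- Traces on `C` lie in the image of `f`, so neither a separating nor a dominating vertex is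
    -- lost on pulling back.
    preimage-code : Covers f C → FTDCode H C → FTDCode G (preimage f C)
    preimage-code cov code = separating , dominating
      where
      reflect : ∀ S T → preimage f (S ∩ C) ≡ preimage f (T ∩ C) → S ∩ C ≡ T ∩ C
      reflect S T = preimage-injective f (S ∩ C) (T ∩ C) (cov ∘ p∩q⊆q S C) (cov ∘ p∩q⊆q T C)

      separating : FullSeparating G (preimage f C)
      separating u v u≢v =
        (λ eq → u≢v (f-injective (Code.N∩-injective H code
          (reflect _ _ (trans (preimage-N∩ u) (trans eq (sym (preimage-N∩ v)))))))) ,
        (λ eq → u≢v (f-injective (Code.N[]∩-injective H code
          (reflect _ _ (trans (preimage-N[]∩ u) (trans eq (sym (preimage-N[]∩ v))))))))

      dominating : TotalDominating G (preimage f C)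
      dominating v with y , y∈ ← proj₂ code (f v)
        with x , refl ← cov (p∩q⊆q (H.N (f v)) C y∈) =
        x , subst (x ∈_) (preimage-N∩ v) (∈-preimage⁺ f _ y∈)

module Induced (G : Graph n) (C : Subset n) where

  open Embedding (G ⟦ C ⟧) G (enum C) (enum-injective C) (λ _ _ → mk⇔ id id) public

  ∩-preimage-enum : ∀ S → S ∩ preimage (enum C) C ≡ S
  ∩-preimage-enum S = trans (cong (S ∩_) (preimage-enum C)) (∩-identityʳ S)

  -- `C` pulls back to `⊤`, so neighbourhoods in the induced graph are just the traces on `C` in the
  -- numbering by `enum C`. Twins of the induced graph can thus be read off from equal traces.
  induced-N : ∀ i → Graph.N (G ⟦ C ⟧) i ≡ preimage (enum C) (Graph.N G (enum C i) ∩ C)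
  induced-N i = sym (trans (preimage-N∩ C i) (∩-preimage-enum (Graph.N (G ⟦ C ⟧) i)))

  induced-N[] : ∀ i → Graph.N[_] (G ⟦ C ⟧) i ≡ preimage (enum C) (Graph.N[_] G (enum C i) ∩ C)
  induced-N[] i = sym (trans (preimage-N[]∩ C i) (∩-preimage-enum (Graph.N[_] (G ⟦ C ⟧) i)))

  code⇒induced-admissible : FTDCode G C → FTDAdmissible (G ⟦ C ⟧)
  code⇒induced-admissible code = preimage (enum C) C , preimage-code C (enum-covers C) code

-- Admissible graphs, and the code of a graph G^F(k)

module _ {G : Graph n} (adm : FTDAdmissible G) where
  private
    C = proj₁ adm
    code = proj₂ adm

  admissible⇒no-openTwins : ∀ u v → ¬ OpenTwins G u v
  admissible⇒no-openTwins u v (u≢v , _ , eq) = u≢v (Code.N∩-injective G code (cong (_∩ C) eq))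

  admissible⇒no-closedTwins : ∀ u v → ¬ ClosedTwins G u v
  admissible⇒no-closedTwins u v (u≢v , _ , eq) = u≢v (Code.N[]∩-injective G code (cong (_∩ C) eq))

  admissible⇒no-isolated : ∀ u → ∃ λ v → Graph._~_ G u v
  admissible⇒no-isolated u =
    let v , v∈ = proj₂ code u in v , ∈N⁻ G (proj₁ (x∈p∩q⁻ (Graph.N G u) C v∈))

-- Two vertices outside `C` are separated by the uniqueness in `index-outside`, a mixed pair by the
-- last clause of `Index`, and two vertices of `C` by the absence of twins in `H ⟦ C ⟧`.
-- Admissibility of `H ⟦ C ⟧` dominates the vertices of `C`.
gf⇒code : ∀ {k} {H : Graph m} {C} → IsGF k H C → FTDAdmissible (H ⟦ C ⟧) → FTDCode H C
gf⇒code {H = H} {C} gf adm = separating , dominating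
  where
  open Graph H
  open IsGF gf
  open Induced H C using (induced-N; induced-N[])

  dominating : TotalDominating H C
  dominating v with v ∈? C
  ... | no v∉C = proj₁ (proj₂ (outside-index v v∉C))
  ... | yes v∈C with i , refl ← enum-covers C v∈C =
    let j , i~j = admissible⇒no-isolated {G = H ⟦ C ⟧} adm i
    in enum C j , x∈p∩q⁺ (∈N⁺ H i~j , enum-∈ C j)

  separating : FullSeparating H C
  separating u v u≢v with u ∈? C | v ∈? C
  ... | no u∉C | no v∉C = N∩≢ , λ eq → N∩≢
          (trans (sym (∉⇒N[]∩≡N∩ H C u∉C)) (trans eq (∉⇒N[]∩≡N∩ H C v∉C)))
    where
    N∩≢ : N u ∩ C ≢ N v ∩ C
    N∩≢ eq = let _ , _ , unique = index-outside (N u ∩ C) (outside-index u u∉C)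
             in u≢v (trans (sym (unique (u∉C , refl))) (unique (v∉C , sym eq)))
  ... | yes u∈C | no v∉C =
    (λ eq → proj₂ (proj₂ (outside-index v v∉C)) (u , u∈C , inj₁ eq)) ,
    (λ eq → proj₂ (proj₂ (outside-index v v∉C)) (u , u∈C , inj₂ (trans eq (∉⇒N[]∩≡N∩ H C v∉C))))
  ... | no u∉C | yes v∈C =
    (λ eq → proj₂ (proj₂ (outside-index u u∉C)) (v , v∈C , inj₁ (sym eq))) ,
    (λ eq → proj₂ (proj₂ (outside-index u u∉C))
      (v , v∈C , inj₂ (trans (sym eq) (∉⇒N[]∩≡N∩ H C u∉C))))
  ... | yes u∈C | yes v∈C
    with i , refl ← enum-covers C u∈C | j , refl ← enum-covers C v∈C =
    (λ eq → no-openTwins i j (i≢j ,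
       -- Adjacency would put `enum C j` into the common trace, hence into its own open
       -- neighbourhood.
       (λ i~j → ~-irrefl _ (∈N⁻ H (∈∩-resp (N (enum C i)) (N (enum C j)) C eq v∈C (∈N⁺ H i~j)))) ,
       trans (induced-N i) (trans (cong (preimage (enum C)) eq) (sym (induced-N j))))) ,
    (λ eq → no-closedTwins i j (i≢j , N[]∩≡⇒~ eq ,
       trans (induced-N[] i) (trans (cong (preimage (enum C)) eq) (sym (induced-N[] j)))))
    where
    i≢j : i ≢ j
    i≢j refl = u≢v refl

    N[]∩≡⇒~ : N[ enum C i ] ∩ C ≡ N[ enum C j ] ∩ C → enum C i ~ enum C j
    -- `enum C j` lies in its own closed trace, hence in `N[ enum C i ]`, and it differs from
    -- `enum C i`.
    N[]∩≡⇒~ eq with x∈p∪q⁻ (N (enum C i)) ⁅ enum C i ⁆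
                      (∈∩-resp N[ enum C j ] N[ enum C i ] C (sym eq) v∈C (v∈N[v] H (enum C j)))
    ... | inj₁ v∈N   = ∈N⁻ H v∈N
    ... | inj₂ v∈⁅u⁆ = contradiction (sym (x∈⁅y⁆⇒x≡y _ v∈⁅u⁆)) u≢v

-- Completion of a graph with an FTD-code to a graph G^F(k)

-- In contrast to `Index`, `u` ranges over all vertices, so these are the traces still free for a
-- new vertex.
Missing : (G : Graph n) (C S : Subset n) → Set
Missing G C S = S ⊆ C × Nonempty S × ¬ (∃ λ u → N u ∩ C ≡ S ⊎ N[ u ] ∩ C ≡ S)
  where open Graph G

realised? : (G : Graph n) (C S : Subset n) →
            let open Graph G in Dec (∃ λ u → N u ∩ C ≡ S ⊎ N[ u ] ∩ C ≡ S)
realised? G C S = Fin.any? λ u → ≡-dec _≟_ (N u ∩ C) S ⊎-dec ≡-dec _≟_ (N[ u ] ∩ C) S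
  where open Graph G

missing? : (G : Graph n) (C S : Subset n) → Dec (Missing G C S)
missing? G C S = S ⊆? C ×-dec nonempty? S ×-dec ¬? (realised? G C S)

-- An index set that is not missing is realised by some vertex. `Index` keeps that vertex out of
-- `C`, where both kinds of trace agree, and separation makes it unique.
complete⇒gf : {G : Graph n} {C : Subset n} → FTDCode G C → 4 ≤ ∣ C ∣ →
              ¬ (∃ (Missing G C)) → IsGF ∣ C ∣ G C
complete⇒gf {G = G} {C} code 4≤ complete = record
  { k≥4            = 4≤
  ; size           = refl
  ; no-openTwins   = admissible⇒no-openTwins {G = G ⟦ C ⟧} adm
  ; no-closedTwins = admissible⇒no-closedTwins {G = G ⟦ C ⟧} adm
  ; outside-index  = λ v v∉C → p∩q⊆q (N v) C , proj₂ code v , λ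
      { (u , u∈C , inj₁ eq) → v∉C (subst (_∈ C) (N∩-injective eq) u∈C)
      ; (u , u∈C , inj₂ eq) → N∩≢N[]∩ u∈C (sym eq) }
  ; index-outside  = index-outside
  }
  where
  open Graph G
  open Code G code
  adm = Induced.code⇒induced-admissible G C code

  index-outside : ∀ S → S ⊆ C × Nonempty S × ¬ (∃ λ u → u ∈ C × (N u ∩ C ≡ S ⊎ N[ u ] ∩ C ≡ S)) →
                  Σ (Fin _) λ v → (v ∉ C × N v ∩ C ≡ S) × (∀ {w} → w ∉ C × N w ∩ C ≡ S → v ≡ w)
  index-outside S (S⊆C , S≢∅ , unused) with realised? G C S
  ... | no ¬real       = Empty.⊥-elim (complete (S , S⊆C , S≢∅ , ¬real))
  ... | yes (v , real) = v , (v∉C , N∩≡S) , λ (_ , eq) → N∩-injective (trans N∩≡S (sym eq))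
    where
    v∉C : v ∉ C
    v∉C v∈C = unused (v , v∈C , real)
    N∩≡S : N v ∩ C ≡ S
    N∩≡S = [ id , trans (sym (∉⇒N[]∩≡N∩ G C v∉C)) ] real

-- The new vertex is `zero`; old vertices are shifted by `suc`, so old adjacencies are kept
-- definitionally.
attach : Graph n → Subset n → Graph (suc n)
attach {n} G S = record
  { _~_      = _~′_
  ; _~?_     = _~′?_
  ; ~-sym    = λ {u} {v} → ~′-sym u v
  ; ~-irrefl = λ { zero () ; (suc v) → ~-irrefl v }
  }
  where
  open Graph G
  _~′_ : Fin (suc n) → Fin (suc n) → Set
  zero  ~′ zero  = Empty.⊥
  zero  ~′ suc v = v ∈ S
  suc u ~′ zero  = u ∈ S
  suc u ~′ suc v = u ~ v

  _~′?_ : ∀ u v → Dec (u ~′ v)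
  zero  ~′? zero  = no λ ()
  zero  ~′? suc v = v ∈? S
  suc u ~′? zero  = u ∈? S
  suc u ~′? suc v = u ~? v

  ~′-sym : ∀ u v → u ~′ v → v ~′ u
  ~′-sym zero    (suc v) p = p
  ~′-sym (suc u) zero    p = p
  ~′-sym (suc u) (suc v) p = ~-sym p

-- The new vertex is outside the code, so old traces do not change, and its own open and closed
-- traces are both `S`, which no old vertex realises.
attach-code : {G : Graph n} {C S : Subset n} → FTDCode G C → Missing G C S →
              FTDCode (attach G S) (outside ∷ C)
attach-code {n} {G} {C} {S} code (S⊆C , (x , x∈S) , unrealised) = separating , dominating
  where
  open Graph G

  S∩C≡S : S ∩ C ≡ S
  S∩C≡S = ⊆-antisym (p∩q⊆p S C) (λ y∈ → x∈p∩q⁺ (y∈ , S⊆C y∈))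

  N-new : tabulate (λ v → does (v ∈? S)) ∩ C ≡ S
  N-new = trans (cong (_∩ C) (tabulate-∈? S)) S∩C≡S

  -- `⊥` is the tail of `⁅ zero ⁆`.
  N[]-new : (tabulate (λ v → does (v ∈? S)) ∪ ⊥) ∩ C ≡ S
  N[]-new = trans (cong (_∩ C) (∪-identityʳ _)) N-new

  separating : FullSeparating (attach G S) (outside ∷ C)
  separating zero    zero    z≢z = contradiction refl z≢z
  separating zero    (suc v) _   =
    (λ eq → unrealised (v , inj₁ (trans (sym (∷-injectiveʳ eq)) N-new))) ,
    (λ eq → unrealised (v , inj₂ (trans (sym (∷-injectiveʳ eq)) N[]-new)))
  separating (suc u) zero    _   =
    (λ eq → unrealised (u , inj₁ (trans (∷-injectiveʳ eq) N-new))) ,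
    (λ eq → unrealised (u , inj₂ (trans (∷-injectiveʳ eq) N[]-new)))
  separating (suc u) (suc v) u≢v =
    (λ eq → u≢v (cong suc (Code.N∩-injective G code (∷-injectiveʳ eq)))) ,
    (λ eq → u≢v (cong suc (Code.N[]∩-injective G code (∷-injectiveʳ eq))))

  dominating : TotalDominating (attach G S) (outside ∷ C)
  dominating zero    = suc x , there (subst (x ∈_) (sym N-new) x∈S)
  dominating (suc v) = let y , y∈ = proj₂ code v in suc y , there y∈

-- The bound on `∣ R ∣` is absent here; `removed-bound` supplies it once the completion is reached.
ObtainedFrom : Graph n → (H : Graph m) → Subset m → Set
ObtainedFrom G H C = ∃ λ R → R ⊆ ∁ C × G ≅ H ⟦ ∁ R ⟧

-- Adding the new vertex to `R` removes it again: the remaining induced graph has definitionally the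
-- same adjacency, so the isomorphism is reused as it is.
attach-obtainedFrom : {G : Graph n} {H : Graph m} {C : Subset m} (S : Subset m) →
                      ObtainedFrom G H C → ObtainedFrom G (attach H S) (outside ∷ C)
attach-obtainedFrom S (R , R⊆∁C , iso) =
  inside ∷ R , (λ { here → here ; (there x∈) → there (R⊆∁C x∈) }) , iso

obtainedFrom-self : (G : Graph n) (C : Subset n) → ObtainedFrom G G C
obtainedFrom-self {n} G C = ⊥ , (λ x∈ → contradiction x∈ ∉⊥) , φ , λ u v →
  mk⇔ (subst₂ _~_ (sym (enum-index u)) (sym (enum-index v)))
      (subst₂ _~_ (enum-index u) (enum-index v))
  where
  open Graph G
  D = ∁ (⊥ {n})
  index : Fin n → Fin ∣ D ∣
  index v = proj₁ (enum-covers D (x∉p⇒x∈∁p (∉⊥ {x = v})))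
  enum-index : ∀ v → enum D (index v) ≡ v
  enum-index v = proj₂ (enum-covers D (x∉p⇒x∈∁p (∉⊥ {x = v})))
  φ : Fin n ↔ Fin ∣ D ∣
  φ = mk↔ₛ′ index (enum D) (λ i → enum-injective D (enum-index (enum D i))) enum-index

-- The fuel d bounds the number of vertices that can still be attached, by order-bound.
complete : (G : Graph n) (k d m : ℕ) (H : Graph m) (C : Subset m) → FTDCode H C → ∣ C ∣ ≡ k →
           2 ^ k ≤ d + m → ObtainedFrom G H C →
           ∃ λ m → Σ (Graph m) λ H → Σ (Subset m) λ C →
             FTDCode H C × ∣ C ∣ ≡ k × ¬ (∃ (Missing H C)) × ObtainedFrom G H C
complete G k zero m H C code refl 2^k≤m from = contradiction
  (ℕ.≤-trans (s≤s (ℕ.m≤m+n m ∣ C ∣)) (ℕ.≤-trans (Code.order-bound H code) 2^k≤m)) (ℕ.<-irrefl refl)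
complete G k (suc d) m H C code size 2^k≤ from with anySubset? (missing? H C)
... | no none       = m , H , C , code , size , none , from
... | yes (S , mis) = complete G k d (suc m) (attach H S) (outside ∷ C) (attach-code code mis) size
  (subst (2 ^ k ≤_) (sym (ℕ.+-suc d m)) 2^k≤) (attach-obtainedFrom {G = G} {H} S from)

-- Arithmetic of the code size and of the number of removed vertices

module _ (n k : ℕ) (k≡ : k ≡ 1 + ⌊log₂ (n + 1) ⌋) (5≤k : 5 ≤ k) where

  2^[k∸1]≤1+n : 2 ^ (k ∸ 1) ≤ 1 + n
  2^[k∸1]≤1+n rewrite k≡ =
    subst (2 ^ ⌊log₂ (n + 1) ⌋ ≤_) (ℕ.+-comm n 1) (2^⌊log₂⌋≤ n)

  -- If `c` were below `k`, then `2 ^ c` would be at most `2 ^ (k ∸ 1)`, hence at most `1 + n`,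
  -- which leaves no room for a positive `c`.
  size-bound : ∀ c → 1 + (n + c) ≤ 2 ^ c → k ≤ c
  -- With `c` zero the summand gives no contradiction; instead `5 ≤ k` makes `1 + n` at least 2.
  size-bound zero 1+n+0≤1 = contradiction 2≤1 ℕ.1+n≰n
    where
    open ℕ.≤-Reasoning
    2≤1 : 2 ≤ 1
    2≤1 = begin
      2 ^ 1        ≤⟨ ℕ.^-monoʳ-≤ 2 (ℕ.≤-trans (s≤s z≤n) (ℕ.∸-monoˡ-≤ 1 5≤k)) ⟩
      2 ^ (k ∸ 1)  ≤⟨ 2^[k∸1]≤1+n ⟩
      1 + n        ≡⟨ ℕ.+-identityʳ (1 + n) ⟨
      1 + (n + 0)  ≤⟨ 1+n+0≤1 ⟩
      1            ∎
  size-bound c@(suc _) 1+n+c≤ = ℕ.≮⇒≥ λ c<k → ℕ.m+1+n≰m (1 + n) (begin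
    1 + (n + c)  ≤⟨ 1+n+c≤ ⟩
    2 ^ c        ≤⟨ ℕ.^-monoʳ-≤ 2 (ℕ.∸-monoˡ-≤ 1 c<k) ⟩
    2 ^ (k ∸ 1)  ≤⟨ 2^[k∸1]≤1+n ⟩
    1 + n        ∎)
    where open ℕ.≤-Reasoning

  -- Of the two copies of `2 ^ (k ∸ 1)` in `2 ^ k`, one is at most `1 + n`. Cancelling it leaves
  -- room for `r + k` in the other.
  removed-bound : ∀ m r → r + n ≤ m → 1 + (m + k) ≤ 2 ^ k → r ≤ 2 ^ (k ∸ 1) ∸ k
  removed-bound m r r+n≤m 1+m+k≤ = ℕ.m+n≤o⇒m≤o∸n r (ℕ.+-cancelʳ-≤ (2 ^ (k ∸ 1)) _ _ (begin
    r + k + 2 ^ (k ∸ 1)            ≤⟨ ℕ.+-monoʳ-≤ (r + k) 2^[k∸1]≤1+n ⟩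
    r + k + (1 + n)                ≡⟨ ℕ.+-suc (r + k) n ⟩
    1 + (r + k + n)                ≡⟨ cong suc r+k+n≡r+n+k ⟩
    1 + (r + n + k)                ≤⟨ s≤s (ℕ.+-monoˡ-≤ k r+n≤m) ⟩
    1 + (m + k)                    ≤⟨ 1+m+k≤ ⟩
    2 ^ k                          ≡⟨ cong (2 ^_) (ℕ.m+[n∸m]≡n {1} (ℕ.≤-trans (s≤s z≤n) 5≤k)) ⟨
    2 ^ (k ∸ 1) + (2 ^ (k ∸ 1) + 0) ≡⟨ cong (2 ^ (k ∸ 1) +_) (ℕ.+-identityʳ _) ⟩
    2 ^ (k ∸ 1) + 2 ^ (k ∸ 1)      ∎))
    where
    open ℕ.≤-Reasoning
    r+k+n≡r+n+k : r + k + n ≡ r + n + k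
    r+k+n≡r+n+k = trans (ℕ.+-assoc r k n)
      (trans (cong (r +_) (ℕ.+-comm k n)) (sym (ℕ.+-assoc r n k)))

ReducedGF : Graph n → ℕ → Set₁
ReducedGF G k =
  ∃ λ (m : ℕ) → Σ (Graph m) λ H → Σ (Subset m) λ C →
    IsGF k H C × FTDAdmissible (H ⟦ C ⟧) ×
    (∃ λ (R : Subset m) →
      R ⊆ ∁ C × ∣ R ∣ ≤ 2 ^ (k ∸ 1) ∸ k × G ≅ H ⟦ ∁ R ⟧)

theorem10 : (n : ℕ) (G : Graph n) → FTDAdmissible G →
    (k : ℕ) → k ≡ 1 + ⌊log₂ (n + 1) ⌋ → 5 ≤ k →
    FTDNumber G k ⇔
    (∃ λ (m : ℕ) → Σ (Graph m) λ H → Σ (Subset m) λ C →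
    IsGF k H C × FTDAdmissible (H ⟦ C ⟧) ×
    (∃ λ (R : Subset m) →
    R ⊆ ∁ C × ∣ R ∣ ≤ 2 ^ (k ∸ 1) ∸ k × G ≅ H ⟦ ∁ R ⟧))
theorem10 n G _ k k≡ 5≤k = mk⇔ to from
  where
  to : FTDNumber G k → ReducedGF G k
  to ((C₀ , code₀ , size₀) , _)
    with m , H , C , code , refl , none , R , R⊆∁C , iso ←
      complete G k (2 ^ k) n G C₀ code₀ size₀ (ℕ.m≤m+n _ n) (obtainedFrom-self G C₀) =
    m , H , C , complete⇒gf code (ℕ.≤-trans (ℕ.n≤1+n 4) 5≤k) none ,
    Induced.code⇒induced-admissible H C code , R , R⊆∁C ,
    removed-bound n k k≡ 5≤k m ∣ R ∣ r+n≤m (Code.order-bound H code) , iso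
    where
    r+n≤m : ∣ R ∣ + n ≤ m
    r+n≤m = subst (∣ R ∣ + n ≤_) (trans (ℕ.+-comm ∣ R ∣ _) (∣∁∣+∣∣ R))
      -- The isomorphism injects the `n` vertices of `G` into `∁ R`.
      (ℕ.+-monoʳ-≤ ∣ R ∣ (Fin.injective⇒≤ (↔-injective (proj₁ iso))))

  lower : ∀ C → FTDCode G C → k ≤ ∣ C ∣
  lower C code = size-bound n k k≡ 5≤k ∣ C ∣ (Code.order-bound G code)

  from : ReducedGF G k → FTDNumber G k
  from (m , H , C , gf , adm , R , R⊆∁C , _ , φ , φ-adj) =
    -- The preimage has at most `k` elements since `f` is injective, and at least `k` because it is
    -- a code.
    (preimage f C , code , ℕ.≤-antisym ∣D∣≤k (lower _ code)) , lower
    where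
    f : Fin n → Fin m
    f = enum (∁ R) ∘ Inverse.to φ
    f-injective : Injective _≡_ _≡_ f
    f-injective = ↔-injective φ ∘ enum-injective (∁ R)
    cov : Covers f C
    -- `R` avoids `C`, so every vertex of `C` survives the removal.
    cov x∈C with i , refl ← enum-covers (∁ R) (x∉p⇒x∈∁p λ x∈R → x∈∁p⇒x∉p (R⊆∁C x∈R) x∈C) =
      Inverse.from φ i , cong (enum (∁ R)) (Inverse.strictlyInverseˡ φ i)
    code : FTDCode G (preimage f C)
    code = Embedding.preimage-code G H f f-injective φ-adj C cov (gf⇒code gf adm)
    ∣D∣≤k : ∣ preimage f C ∣ ≤ k
    ∣D∣≤k = subst (∣ preimage f C ∣ ≤_) (IsGF.size gf) (∣preimage∣≤ f f-injective C)
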